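{- Let $n\ge1$ and let $\mathbf{m}=(m_1,\dots,m_n)$, $\mathbf{r}=(r_1,\dots,r_n)$ be vectors of positive integers. The colored multiset Eulerian polynomial $A_{\mathbf{m}}^{\mathbf{r}}$ is symmetric with respect to its degree if and only if $$\max_{1\le k\le n}\left\lceil\frac{m_k+1}{r_k}\right\rceil\cdot r_j=m_j+1\qquad\text{for all } j\in\{1,\dots,n\}.$$
   Context: Let $m=m_1+\cdots+m_n$. A colored multiset permutation in $\mathfrak{S}_{\mathbf{m}}^{\mathbf{r}}$ is a word $\pi^{\mathbf{c}}=\pi_1^{c_1}\cdots\pi_m^{c_m}$ in which each $k\in\{1,\dots,n\}$ appears exactly $m_k$ times among $\pi_1,\dots,\pi_m$, and $1\le c_j\le r_{\pi_j}$ for all $j$. One always appends $\pi_{m+1}^{c_{m+1}}:=(n+1)^1$. Colored letters are totally ordered by $k^{c}<l^{c'}$ iff $c<c'$, or $c=c'$ and $k<l$. A descent is an index $j\in\{1,\dots,m\}$ with $\pi_j^{c_j}>\pi_{j+1}^{c_{j+1}}$, and $\mathrm{des}(\pi^{\mathbf{c}})$ is the number of descents. The colored multiset Eulerian polynomial is $A_{\mathbf{m}}^{\mathbf{r}}=\sum_{\pi^{\mathbf{c}}\in\mathfrak{S}_{\mathbf{m}}^{\mathbf{r}}}x^{\mathrm{des}(\pi^{\mathbf{c}})}$. A polynomial $p=\sum_s p_sx^s$ of degree at most $d$ is symmetric with respect to degree $d$ if $p_s=p_{d-s}$ for all $s=0,\dots,d$. -}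

module Defs where

open import Data.Bool.Base using (if_then_else_)
open import Data.Fin.Base using (Fin; suc; toℕ; inject₁)
import Data.Fin.Properties as Fin
open import Data.Integer.Base using (+_; ∣_∣)
open import Data.List.Base as List using (List; [_]; concatMap; cartesianProductWith)
open import Data.List.Extrema.Nat using (max)
open import Data.Nat.Base using (ℕ; zero; suc; _∸_; _≤_; _<_; NonZero)
open import Data.Nat.ListAction using (sum)
import Data.Nat.Properties as ℕ
open import Data.Product.Base using (Σ; _×_; _,_; proj₁; ∃-syntax)
open import Data.Product.Relation.Binary.Lex.Strict using (×-Lex; ×-decidable)
open import Data.Rational.Unnormalised.Base using (_/_; ceiling)
open import Data.Vec.Base as Vec using (Vec; []; _∷_; _∷ʳ_; lookup; count)
open import Relation.Binary.Core using (Rel)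
open import Relation.Binary.Definitions using (Decidable)
open import Relation.Binary.PropositionalEquality.Core using (_≡_; _≢_)
open import Relation.Nullary.Decidable.Core using (does)
import Relation.Unary as Unary

-- A polynomial is given by its coefficient sequence; those used here have
-- finite support.
Poly : Set
Poly = ℕ → ℕ

X^_ : ℕ → Poly
(X^ d) s = if does (s ℕ.≟ d) then 1 else 0

∑ : {A : Set} → List A → (A → Poly) → Poly
∑ xs f s = sum (List.map (λ x → f x s) xs)

HasDegree : Poly → ℕ → Set
HasDegree p d = p d ≢ 0 × (∀ s → d < s → p s ≡ 0)

SymmetricWrt : ℕ → Poly → Set
SymmetricWrt d p = ∀ s → s ≤ d → p s ≡ p (d ∸ s)

SymmetricWrtDegree : Poly → Set
SymmetricWrtDegree p = ∃[ d ] HasDegree p d × SymmetricWrt d p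

-- A pair (c , k) stands for the colored letter kᶜ, so that the order on
-- colored letters is the lexicographic one.
ColoredLetter : Set
ColoredLetter = ℕ × ℕ

_≺_ : Rel ColoredLetter _
_≺_ = ×-Lex _≡_ _<_ _<_

_≺?_ : Decidable _≺_
_≺?_ = ×-decidable ℕ._≟_ ℕ._<?_ ℕ._<?_

module _ {n : ℕ} (m r : Fin n → ℕ) where

  -- Letters and colors are counted from 1 in the mathematics and from 0 in
  -- Fin; ⟦_⟧ makes the shift.
  Letter : Set
  Letter = Σ (Fin n) λ k → Fin (r k)

  ⟦_⟧ : Letter → ColoredLetter
  ⟦ k , c ⟧ = suc (toℕ c) , suc (toℕ k)

  ∣𝐦∣ : ℕ
  ∣𝐦∣ = sum (List.tabulate m)

  Word : ℕ → Set
  Word ℓ = Vec Letter ℓ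

  IsMultisetPermutation : Unary.Pred (Word ∣𝐦∣) _
  IsMultisetPermutation w = ∀ k → count (λ x → proj₁ x Fin.≟ k) w ≡ m k

  isMultisetPermutation? : Unary.Decidable IsMultisetPermutation
  isMultisetPermutation? w = Fin.all? λ k → count (λ x → proj₁ x Fin.≟ k) w ℕ.≟ m k

  letters : List Letter
  letters = concatMap (λ k → List.map (k ,_) (List.allFin (r k))) (List.allFin n)

  words : ∀ ℓ → List (Word ℓ)
  words zero    = [ [] ]
  words (suc ℓ) = cartesianProductWith _∷_ letters (words ℓ)

  -- The list has no repetitions, so summing over it is summing over the set
  -- of colored multiset permutations.
  𝔖 : List (Word ∣𝐦∣)
  𝔖 = List.filter isMultisetPermutation? (words ∣𝐦∣)

  -- The word followed by the letter n + 1 of color 1.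
  extend : ∀ {ℓ} → Word ℓ → Vec ColoredLetter (suc ℓ)
  extend w = Vec.map ⟦_⟧ w ∷ʳ (1 , suc n)

  Descent : ∀ {ℓ} → Word ℓ → Unary.Pred (Fin ℓ) _
  Descent w j = lookup (extend w) (suc j) ≺ lookup (extend w) (inject₁ j)

  descent? : ∀ {ℓ} (w : Word ℓ) → Unary.Decidable (Descent w)
  descent? w j = lookup (extend w) (suc j) ≺? lookup (extend w) (inject₁ j)

  des : ∀ {ℓ} → Word ℓ → ℕ
  des {ℓ} w = count (descent? w) (Vec.allFin ℓ)

  eulerian : Poly
  eulerian = ∑ 𝔖 λ w → X^ (des w)

  -- The ceilings are positive, so neither ∣_∣ nor the default value 0 of the
  -- maximum changes the result when n ≥ 1.
  maxCeiling : (∀ k → NonZero (r k)) → ℕ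
  maxCeiling r≢0 =
    max 0 (List.tabulate λ k → ∣ ceiling (_/_ (+ suc (m k)) (r k) {{r≢0 k}}) ∣)

module Submission where

-- Write M = |m|.  Two Worpitzky-type identities hold for every t ≥ 0:
--
--   ∑_w C(t + M - des w, M) = ∏_k C(t r_k + m_k, m_k),
--   ∑_w C(t + des w, M)     = ∏_k C((t + 1) r_k - 1, m_k).
--
-- Both sides count the ways to read a word off a list made of copies of the
-- increasing (decreasing) list of all letters, the last copy being cut off at
-- (n+1)¹, where positions have to increase weakly (strictly): for a given word
-- this only depends on des w, and for all words together each letter k chooses
-- its positions independently.
--
-- The first identity at t = 0 shows that the constant term is 1.  If A is
-- symmetric with respect to its degree d, then the second at t = M - d says
-- 1 = A_d = ∏_k C((M + 1 - d) r_k - 1, m_k), which forces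
-- (M + 1 - d) r_k = m_k + 1 for all k.  Conversely, if a r_k = m_k + 1 for all
-- k, then the right hand side of the first identity at t is that of the second
-- at t + a - 1.  As 1/(1-x)^(M+1) is invertible, this gives A_s = A_{d-s} for
-- d = M + 1 - a; the bound des w ≤ d comes from the second identity at
-- t = a - 2, where the right hand side vanishes.

open import Data.Bool.Base using (Bool; true; false; if_then_else_; not)
import Data.Bool.Properties as Bool
open import Data.Fin.Base using (Fin; zero; suc; toℕ; fromℕ<)
import Data.Fin.Properties as Fin
open import Data.Integer.Base as ℤ using (∣_∣)
open import Data.Integer.DivMod using (div-pos-is-/ℕ)
open import Data.Integer.Properties using (neg-involutive)
open import Data.List.Base as List using (List; []; _∷_; _++_; cartesianProductWith; concatMap; filter)
open import Data.List.Extrema.Nat using (max; max≤v⁺; v≤max⁺)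
import Data.List.Membership.DecPropositional as DecMembership
open import Data.List.Membership.Propositional using (_∈_)
open import Data.List.Membership.Propositional.Properties
  using (∈-allFin; ∈-concatMap⁺; ∈-filter⁺; ∈-map⁺; ∈-map⁻; ∈-++⁺ˡ; ∈-++⁺ʳ)
open import Data.List.Properties using (length-tabulate; map-++; map-∘; ++-identityʳ)
open import Data.List.Relation.Binary.Disjoint.Propositional using (Disjoint)
open import Data.List.Relation.Binary.Permutation.Propositional using (_↭_; ↭-sym; ↭⇒↭ₛ)
open import Data.List.Relation.Binary.Permutation.Propositional.Properties using (∈-resp-↭; map⁺)
import Data.List.Relation.Binary.Permutation.Setoid.Properties as Permutation
open import Data.List.Relation.Unary.All as All using (All; []; _∷_)
import Data.List.Relation.Unary.All.Properties as All
open import Data.List.Relation.Unary.AllPairs as AllPairs using (AllPairs; []; _∷_)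
import Data.List.Relation.Unary.AllPairs.Properties as AllPairs
open import Data.List.Relation.Unary.Any as Any using (here; there)
import Data.List.Relation.Unary.Any.Properties as Any
open import Data.List.Relation.Unary.Sorted.TotalOrder.Properties using (Sorted⇒AllPairs)
open import Data.List.Relation.Unary.Unique.Propositional using (Unique)
import Data.List.Relation.Unary.Unique.Propositional.Properties as Unique
import Data.List.Sort as Sort
open import Data.Nat.Base hiding (compare; _/_)
open import Data.Nat.Combinatorics using (_C_; k>n⇒nCk≡0; nCn≡1; nC1≡n; nCk+nC[k+1]≡[n+1]C[k+1])
import Data.Nat.DivMod as ℕ
open import Data.Nat.ListAction using (sum; product)
open import Data.Nat.ListAction.Properties using (sum-++; sum-↭)
import Data.Nat.Properties as ℕ
open import Algebra.Properties.CommutativeSemigroup ℕ.+-commutativeSemigroup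
  using (interchange; x∙yz≈y∙xz)
open import Data.Product.Base using (_×_; _,_; proj₁; proj₂; ∃-syntax)
open import Data.Product.Properties using (≡-dec; ,-injectiveˡ; ,-injectiveʳ)
open import Data.Product.Relation.Binary.Lex.Strict using (×-transitive; ×-compare)
open import Data.Rational.Unnormalised.Base using (_/_; ceiling)
open import Data.Sum.Base using (_⊎_; inj₁; inj₂)
open import Data.Vec.Base as Vec using (Vec; []; _∷_; count; lookup)
open import Data.Vec.Functional using (updateAt)
open import Data.Vec.Functional.Properties using (updateAt-updates; updateAt-minimal)
open import Function.Base using (_∘_; id)
open import Function.Bundles using (_⇔_; mk⇔; Equivalence)
open import Level using (0ℓ)
open import Relation.Binary.Bundles using (DecTotalOrder; StrictTotalOrder)
import Relation.Binary.Construct.Flip.EqAndOrd as Flip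
import Relation.Binary.Construct.On as On
open import Relation.Binary.Core using (Rel)
open import Relation.Binary.Definitions
  using (Decidable; DecidableEquality; Trichotomous; tri<; tri≈; tri>)
import Relation.Binary.Properties.StrictTotalOrder as StrictTotalOrderProperties
open import Relation.Binary.PropositionalEquality
open import Relation.Binary.Structures using (IsStrictTotalOrder)
open import Relation.Binary.Structures.Biased using (isStrictTotalOrderᶜ)
open import Relation.Nullary.Decidable using (Dec; does; yes; no; dec-true; dec-false; does-⇔; ¬?)
open import Relation.Nullary.Negation using (contradiction; ¬_)
import Relation.Unary as Unary
open import Defs

private variable
  A B D : Set
  n : ℕ

-- Finite sums over lists.

sumOver : List A → (A → ℕ) → ℕ
sumOver xs f = sum (List.map f xs)

sumOver-cong : ∀ (xs : List A) {f g : A → ℕ} →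
  (∀ {x} → x ∈ xs → f x ≡ g x) → sumOver xs f ≡ sumOver xs g
sumOver-cong []       f≗g = refl
sumOver-cong (x ∷ xs) f≗g = cong₂ _+_ (f≗g (here refl)) (sumOver-cong xs (f≗g ∘ there))

sumOver-zero : ∀ (xs : List A) {f : A → ℕ} →
  (∀ {x} → x ∈ xs → f x ≡ 0) → sumOver xs f ≡ 0
sumOver-zero []       f≗0 = refl
sumOver-zero (x ∷ xs) f≗0 = cong₂ _+_ (f≗0 (here refl)) (sumOver-zero xs (f≗0 ∘ there))

sumOver-zero⁻ : ∀ (xs : List A) {f : A → ℕ} →
  sumOver xs f ≡ 0 → ∀ {x} → x ∈ xs → f x ≡ 0
sumOver-zero⁻ (x ∷ xs) {f} Σ≡0 (here refl) = ℕ.m+n≡0⇒m≡0 _ Σ≡0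
sumOver-zero⁻ (x ∷ xs) {f} Σ≡0 (there y∈)  = sumOver-zero⁻ xs (ℕ.m+n≡0⇒n≡0 (f x) Σ≡0) y∈

sumOver-+ : ∀ (xs : List A) (f g : A → ℕ) →
  sumOver xs (λ x → f x + g x) ≡ sumOver xs f + sumOver xs g
sumOver-+ []       f g = refl
sumOver-+ (x ∷ xs) f g =
  trans (cong (f x + g x +_) (sumOver-+ xs f g)) (interchange (f x) (g x) _ _)

sumOver-++ : ∀ (xs ys : List A) (f : A → ℕ) →
  sumOver (xs ++ ys) f ≡ sumOver xs f + sumOver ys f
sumOver-++ xs ys f = trans (cong sum (map-++ f xs ys)) (sum-++ (List.map f xs) _)

sumOver-map : ∀ (g : B → A) (xs : List B) (f : A → ℕ) →
  sumOver (List.map g xs) f ≡ sumOver xs (f ∘ g)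
sumOver-map g xs f = cong sum (sym (map-∘ xs))

sumOver-concatMap : ∀ (g : B → List A) (xs : List B) (f : A → ℕ) →
  sumOver (concatMap g xs) f ≡ sumOver xs (λ x → sumOver (g x) f)
sumOver-concatMap g []       f = refl
sumOver-concatMap g (x ∷ xs) f = trans (sumOver-++ (g x) _ f)
  (cong (sumOver (g x) f +_) (sumOver-concatMap g xs f))

sumOver-cartesianProductWith : ∀ (h : A → B → D) xs ys (f : D → ℕ) →
  sumOver (cartesianProductWith h xs ys) f ≡ sumOver xs (λ x → sumOver ys (λ y → f (h x y)))
sumOver-cartesianProductWith h []       ys f = refl
sumOver-cartesianProductWith h (x ∷ xs) ys f = trans (sumOver-++ (List.map (h x) ys) _ f)
  (cong₂ _+_ (sumOver-map (h x) ys f) (sumOver-cartesianProductWith h xs ys f))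

sumOver-filter : ∀ {P : Unary.Pred A 0ℓ} (P? : Unary.Decidable P) xs (f : A → ℕ) →
  sumOver (filter P? xs) f ≡ sumOver xs (λ x → if does (P? x) then f x else 0)
sumOver-filter P? []       f = refl
sumOver-filter P? (x ∷ xs) f with does (P? x)
... | true  = cong (f x +_) (sumOver-filter P? xs f)
... | false = sumOver-filter P? xs f

sumOver-partition : ∀ {P : Unary.Pred A 0ℓ} (P? : Unary.Decidable P) xs (f : A → ℕ) →
  sumOver (filter P? xs) f + sumOver (filter (¬? ∘ P?) xs) f ≡ sumOver xs f
sumOver-partition P? []       f = refl
sumOver-partition P? (x ∷ xs) f with does (P? x)
... | true  = trans (ℕ.+-assoc (f x) _ _) (cong (f x +_) (sumOver-partition P? xs f))
... | false = trans (x∙yz≈y∙xz (sumOver (filter P? xs) f) (f x) _)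
                    (cong (f x +_) (sumOver-partition P? xs f))

sumOver-one : ∀ (xs : List A) → sumOver xs (λ _ → 1) ≡ List.length xs
sumOver-one []       = refl
sumOver-one (x ∷ xs) = cong suc (sumOver-one xs)

sumOver-single : ∀ {xs : List A} {z} (f : A → ℕ) → Unique xs → z ∈ xs →
  (∀ {x} → x ≢ z → f x ≡ 0) → sumOver xs f ≡ f z
sumOver-single {xs = z ∷ xs} f (z∉ ∷ _) (here refl) f≗0 = trans
  (cong (f z +_) (sumOver-zero xs λ x∈ → f≗0 (≢-sym (All.lookup z∉ x∈))))
  (ℕ.+-identityʳ (f z))
sumOver-single {xs = x ∷ xs} f (x∉ ∷ u) (there z∈) f≗0 =
  cong₂ _+_ (f≗0 (All.lookup x∉ z∈)) (sumOver-single f u z∈ f≗0)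

-- Prefix sums, or multiplication of power series by 1/(1-x).

prefixSum : Poly → Poly
prefixSum p zero    = p zero
prefixSum p (suc t) = prefixSum p t + p (suc t)

prefixSum-cong : ∀ {p q} → p ≗ q → prefixSum p ≗ prefixSum q
prefixSum-cong p≗q zero    = p≗q zero
prefixSum-cong p≗q (suc t) = cong₂ _+_ (prefixSum-cong p≗q t) (p≗q (suc t))

-- Each coefficient is the increment between consecutive prefix sums, so cancellation in `ℕ`
-- recovers it without any multiplication by 1 - x.
prefixSum-injective : ∀ {p q} → prefixSum p ≗ prefixSum q → p ≗ q
prefixSum-injective         eq zero    = eq zero
prefixSum-injective {p} {q} eq (suc t) = ℕ.+-cancelˡ-≡ (prefixSum q t) _ _
  (trans (cong (_+ p (suc t)) (sym (eq t))) (eq (suc t)))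

prefixSum-∑ : ∀ (xs : List A) (f : A → Poly) → prefixSum (∑ xs f) ≗ ∑ xs (prefixSum ∘ f)
prefixSum-∑ xs f zero    = refl
prefixSum-∑ xs f (suc t) = trans (cong (_+ ∑ xs f (suc t)) (prefixSum-∑ xs f t))
  (sym (sumOver-+ xs (λ x → prefixSum (f x) t) (λ x → f x (suc t))))

prefixSum^ : ℕ → Poly → Poly
prefixSum^ zero    p = p
prefixSum^ (suc j) p = prefixSum (prefixSum^ j p)

prefixSum^-injective : ∀ j {p q} → prefixSum^ j p ≗ prefixSum^ j q → p ≗ q
prefixSum^-injective zero    eq = eq
prefixSum^-injective (suc j) eq = prefixSum^-injective j (prefixSum-injective eq)

prefixSum^-∑ : ∀ j (xs : List A) (f : A → Poly) →
  prefixSum^ j (∑ xs f) ≗ ∑ xs (prefixSum^ j ∘ f)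
prefixSum^-∑ zero    xs f t = refl
prefixSum^-∑ (suc j) xs f t =
  trans (prefixSum-cong (prefixSum^-∑ j xs f) t) (prefixSum-∑ xs (prefixSum^ j ∘ f) t)

prefixSum^-zero : ∀ j p → prefixSum^ j p 0 ≡ p 0
prefixSum^-zero zero    p = refl
prefixSum^-zero (suc j) p = prefixSum^-zero j p

-- Beyond the range of Pascal's rule proper, all three terms vanish if k > 0.
pascal-∸ : ∀ a b k → b ≤ a ⊎ k > 0 → (suc a ∸ b) C suc k ≡ (a ∸ b) C suc k + (a ∸ b) C k
pascal-∸ a b k h with b ℕ.≤? a
... | yes b≤a rewrite ℕ.+-∸-assoc 1 b≤a =
  trans (sym (nCk+nC[k+1]≡[n+1]C[k+1] (a ∸ b) k)) (ℕ.+-comm ((a ∸ b) C k) _)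
pascal-∸ a b k       (inj₁ b≤a) | no b≰a = contradiction b≤a b≰a
pascal-∸ a b (suc k) (inj₂ _)   | no b≰a
  rewrite ℕ.m≤n⇒m∸n≡0 (ℕ.≰⇒> b≰a) | ℕ.m≤n⇒m∸n≡0 (ℕ.≰⇒≥ b≰a) = refl

X^-refl : ∀ d → (X^ d) d ≡ 1
X^-refl d rewrite dec-true (d ℕ.≟ d) refl = refl

X^-≢ : ∀ {d s} → s ≢ d → (X^ d) s ≡ 0
X^-≢ {d} {s} s≢d rewrite dec-false (s ℕ.≟ d) s≢d = refl

prefixSum-X^-< : ∀ {d t} → t < d → prefixSum (X^ d) t ≡ 0
prefixSum-X^-< {d} {zero}  t<d = X^-≢ (ℕ.<⇒≢ t<d)
prefixSum-X^-< {d} {suc t} t<d =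
  cong₂ _+_ (prefixSum-X^-< (ℕ.<-trans (ℕ.n<1+n t) t<d)) (X^-≢ (ℕ.<⇒≢ t<d))

prefixSum-X^-≥ : ∀ {d t} → d ≤ t → prefixSum (X^ d) t ≡ 1
prefixSum-X^-≥ {zero}  {zero}  d≤t = refl
prefixSum-X^-≥ {d} {suc t} d≤t with d ℕ.≟ suc t
... | yes refl = cong₂ _+_ (prefixSum-X^-< (ℕ.n<1+n t)) (X^-refl d)
... | no  d≢   = cong₂ _+_ (prefixSum-X^-≥ (s≤s⁻¹ (ℕ.≤∧≢⇒< d≤t d≢))) (X^-≢ (≢-sym d≢))

prefixSum²-X^ : ∀ d t → prefixSum^ 2 (X^ d) t ≡ suc t ∸ d
prefixSum²-X^ zero    zero    = refl
prefixSum²-X^ (suc d) zero    = sym (ℕ.0∸n≡0 d)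
prefixSum²-X^ d       (suc t) with d ℕ.≤? suc t
... | yes d≤ = trans (cong₂ _+_ (prefixSum²-X^ d t) (prefixSum-X^-≥ d≤))
                     (trans (ℕ.+-comm _ 1) (sym (ℕ.+-∸-assoc 1 d≤)))
... | no  d≰ = trans (cong₂ _+_ (prefixSum²-X^ d t) (prefixSum-X^-< (ℕ.≰⇒> d≰)))
  (trans (ℕ.+-identityʳ _)
         (trans (ℕ.m≤n⇒m∸n≡0 (ℕ.≰⇒≥ d≰)) (sym (ℕ.m≤n⇒m∸n≡0 (ℕ.≰⇒> d≰)))))

-- Taking prefix sums is multiplication by 1/(1-x).  The index is shifted
-- because (t + m ∸ d) C m is 1 instead of 0 if m = 0 and t < d.
prefixSum^-X^ : ∀ m d t → prefixSum^ (2 + m) (X^ d) t ≡ (t + suc m ∸ d) C suc m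
prefixSum^-X^ zero    d t       = trans (prefixSum²-X^ d t)
  (trans (cong (_∸ d) (ℕ.+-comm 1 t)) (sym (nC1≡n (t + 1 ∸ d))))
prefixSum^-X^ (suc m) zero    zero    = trans (prefixSum^-X^ m zero zero)
  (trans (nCn≡1 (suc m)) (sym (nCn≡1 (suc (suc m)))))
prefixSum^-X^ (suc m) (suc d) zero    = trans (prefixSum^-X^ m (suc d) zero)
  (trans (k>n⇒nCk≡0 (s≤s (ℕ.m∸n≤m m d))) (sym (k>n⇒nCk≡0 (s≤s (ℕ.m∸n≤m (suc m) d)))))
prefixSum^-X^ (suc m) d (suc t) = trans
  (cong₂ _+_ (prefixSum^-X^ (suc m) d t) (prefixSum^-X^ m d (suc t)))
  (trans (cong (λ a → (t + suc (suc m) ∸ d) C suc (suc m) + (a ∸ d) C suc m)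
               (sym (ℕ.+-suc t (suc m))))
         (sym (pascal-∸ (t + suc (suc m)) d (suc m) (inj₂ z<s))))

-- Counting choices, finite products and binomial coefficients.

-- The number of ways to choose c times one of n objects, with (false) or
-- without (true) replacement.
choose : Bool → ℕ → ℕ → ℕ
choose b n       zero    = 1
choose b zero    (suc c) = 0
choose b (suc n) (suc c) = choose b n (suc c) + choose b (if b then n else suc n) c

choose-true : ∀ n c → choose true n c ≡ n C c
choose-true n       zero    = refl
choose-true zero    (suc c) = refl
choose-true (suc n) (suc c) = trans
  (cong₂ _+_ (choose-true n (suc c)) (choose-true n c))
  (sym (pascal-∸ n 0 c (inj₁ z≤n)))

choose-false : ∀ n c → choose false (suc n) c ≡ (n + c) C c
choose-false n       zero    = refl
choose-false zero    (suc c) = trans (choose-false zero c)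
  (trans (nCn≡1 c) (sym (nCn≡1 (suc c))))
choose-false (suc n) (suc c) = trans
  (cong₂ _+_ (choose-false n (suc c)) (choose-false (suc n) c))
  (trans (cong (λ a → (n + suc c) C suc c + a C c) (sym (ℕ.+-suc n c)))
         (sym (pascal-∸ (n + suc c) 0 c (inj₁ z≤n))))

∏ : (Fin n → ℕ) → ℕ
∏ f = product (List.tabulate f)

∏-cong : {f g : Fin n → ℕ} → f ≗ g → ∏ f ≡ ∏ g
∏-cong {zero}  f≗g = refl
∏-cong {suc n} f≗g = cong₂ _*_ (f≗g zero) (∏-cong (f≗g ∘ suc))

∏-zero : {f : Fin n → ℕ} → ∀ k → f k ≡ 0 → ∏ f ≡ 0
∏-zero     zero    fk≡0 rewrite fk≡0 = refl
∏-zero {f = f} (suc k) fk≡0 rewrite ∏-zero {f = f ∘ suc} k fk≡0 = ℕ.*-zeroʳ (f zero)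

∏-one : {f : Fin n → ℕ} → (∀ k → f k ≡ 1) → ∏ f ≡ 1
∏-one {zero}  f≗1 = refl
∏-one {suc n} f≗1 = cong₂ _*_ (f≗1 zero) (∏-one (f≗1 ∘ suc))

∏-one⁻ : {f : Fin n → ℕ} → ∏ f ≡ 1 → ∀ k → f k ≡ 1
∏-one⁻ {f = f} ∏≡1 zero    = ℕ.m*n≡1⇒m≡1 (f zero) _ ∏≡1
∏-one⁻ {f = f} ∏≡1 (suc k) = ∏-one⁻ (ℕ.m*n≡1⇒n≡1 (f zero) _ ∏≡1) k

-- Multilinearity in the factor at `k`. It lifts the recursion of `choose` for one letter to the
-- product over all letters.
∏-+ : {f g h : Fin n → ℕ} → ∀ k → f k ≡ g k + h k →
  (∀ j → j ≢ k → f j ≡ g j × f j ≡ h j) → ∏ f ≡ ∏ g + ∏ h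
∏-+ {f = f} {g} {h} zero at-k off-k = begin
  f zero * ∏ (f ∘ suc)                        ≡⟨ cong (_* ∏ (f ∘ suc)) at-k ⟩
  (g zero + h zero) * ∏ (f ∘ suc)             ≡⟨ ℕ.*-distribʳ-+ (∏ (f ∘ suc)) (g zero) (h zero) ⟩
  g zero * ∏ (f ∘ suc) + h zero * ∏ (f ∘ suc) ≡⟨ cong₂ (λ a b → g zero * a + h zero * b)
                                                   (∏-cong λ j → proj₁ (off-k (suc j) λ ()))
                                                   (∏-cong λ j → proj₂ (off-k (suc j) λ ())) ⟩
  g zero * ∏ (g ∘ suc) + h zero * ∏ (h ∘ suc) ∎
  where open ≡-Reasoning
∏-+ {f = f} {g} {h} (suc k) at-k off-k = begin
  f zero * ∏ (f ∘ suc)                        ≡⟨ cong (f zero *_) (∏-+ k at-k λ j j≢k →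
                                                   off-k (suc j) (j≢k ∘ Fin.suc-injective)) ⟩
  f zero * (∏ (g ∘ suc) + ∏ (h ∘ suc))        ≡⟨ ℕ.*-distribˡ-+ (f zero) (∏ (g ∘ suc)) _ ⟩
  f zero * ∏ (g ∘ suc) + f zero * ∏ (h ∘ suc) ≡⟨ cong₂ (λ a b → a * ∏ (g ∘ suc) + b * ∏ (h ∘ suc))
                                                   (proj₁ (off-k zero λ ())) (proj₂ (off-k zero λ ())) ⟩
  g zero * ∏ (g ∘ suc) + h zero * ∏ (h ∘ suc) ∎
  where open ≡-Reasoning

∏-choose-zero : ∀ b {c : Fin n → ℕ} → sum (List.tabulate c) > 0 → ∏ (λ k → choose b 0 (c k)) ≡ 0
∏-choose-zero {suc n} b {c} Σc>0 with c zero
... | zero  = trans (ℕ.+-identityʳ _) (∏-choose-zero b {c ∘ suc} Σc>0)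
... | suc _ = refl

sum-tabulate-zero⁻ : {c : Fin n → ℕ} → sum (List.tabulate c) ≡ 0 → ∀ k → c k ≡ 0
sum-tabulate-zero⁻         Σc≡0 zero    = ℕ.m+n≡0⇒m≡0 _ Σc≡0
sum-tabulate-zero⁻ {c = c} Σc≡0 (suc k) = sum-tabulate-zero⁻ (ℕ.m+n≡0⇒n≡0 (c zero) Σc≡0) k

sum-tabulate-cong : {c e : Fin n → ℕ} → c ≗ e → sum (List.tabulate c) ≡ sum (List.tabulate e)
sum-tabulate-cong {zero}  c≗e = refl
sum-tabulate-cong {suc n} c≗e = cong₂ _+_ (c≗e zero) (sum-tabulate-cong (c≗e ∘ suc))

sum-tabulate-suc : {c e : Fin n → ℕ} → ∀ k → c k ≡ suc (e k) → (∀ j → j ≢ k → c j ≡ e j) →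
  sum (List.tabulate c) ≡ suc (sum (List.tabulate e))
sum-tabulate-suc {c = c} {e} zero at-k off-k =
  cong₂ _+_ at-k (sum-tabulate-cong λ j → off-k (suc j) λ ())
sum-tabulate-suc {c = c} {e} (suc k) at-k off-k = trans
  (cong₂ _+_ (off-k zero λ ())
             (sum-tabulate-suc k at-k λ j j≢k → off-k (suc j) (j≢k ∘ Fin.suc-injective)))
  (ℕ.+-suc (e zero) _)

≤-sum-tabulate : ∀ (c : Fin n → ℕ) k → c k ≤ sum (List.tabulate c)
≤-sum-tabulate c zero    = ℕ.m≤m+n (c zero) _
≤-sum-tabulate c (suc k) = ℕ.m≤n⇒m≤o+n (c zero) (≤-sum-tabulate (c ∘ suc) k)

k≤n⇒nCk>0 : ∀ {k n} → k ≤ n → n C k > 0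
k≤n⇒nCk>0 {zero}          _         = z<s
k≤n⇒nCk>0 {suc k} {suc n} (s≤s k≤n) = subst (_> 0) (nCk+nC[k+1]≡[n+1]C[k+1] n k)
  (ℕ.m≤n⇒m≤n+o _ (k≤n⇒nCk>0 k≤n))

nCk≡0⇒n<k : ∀ {k n} → n C k ≡ 0 → n < k
nCk≡0⇒n<k nCk≡0 = ℕ.≰⇒> λ k≤n → ℕ.<⇒≢ (k≤n⇒nCk>0 k≤n) (sym nCk≡0)

-- For n > k, Pascal's rule makes the binomial a sum of two positive terms, hence at least 2. The
-- bound `k > 0` excludes C(n, 0) = 1.
nCk≡1⇒n≡k : ∀ {k n} → k > 0 → n C k ≡ 1 → n ≡ k
nCk≡1⇒n≡k {suc k} {n} k>0 nCk≡1 with ℕ.<-cmp n (suc k)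
... | tri< n<k _ _ = contradiction (trans (sym nCk≡1) (k>n⇒nCk≡0 n<k)) λ ()
... | tri≈ _ n≡k _ = n≡k
nCk≡1⇒n≡k {suc k} {suc n} k>0 nCk≡1 | tri> _ _ k<n =
  contradiction (trans (nCk+nC[k+1]≡[n+1]C[k+1] n k) nCk≡1)
    (≢-sym (ℕ.<⇒≢ (ℕ.+-mono-≤ (k≤n⇒nCk>0 (ℕ.<⇒≤ (s≤s⁻¹ k<n))) (k≤n⇒nCk>0 (s≤s⁻¹ k<n)))))

X^-∸ : ∀ {d e s} → e ≤ d → s ≤ d → (X^ (d ∸ e)) s ≡ (X^ e) (d ∸ s)
X^-∸ {d} {e} {s} e≤d s≤d = cong (if_then 1 else 0) (does-⇔ (mk⇔
  (λ { refl → ℕ.m∸[m∸n]≡n e≤d }) (λ { refl → sym (ℕ.m∸[m∸n]≡n s≤d) }))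
  (s ℕ.≟ d ∸ e) (d ∸ s ℕ.≟ e))

𝟙 : Bool → ℕ
𝟙 b = if b then 1 else 0

count-tabulate-cong : ∀ {A B : Set} {P : Unary.Pred A 0ℓ} {Q : Unary.Pred B 0ℓ}
  (P? : Unary.Decidable P) (Q? : Unary.Decidable Q) {ℓ} (f : Fin ℓ → A) (g : Fin ℓ → B) →
  (∀ i → does (P? (f i)) ≡ does (Q? (g i))) →
  count P? (Vec.tabulate f) ≡ count Q? (Vec.tabulate g)
count-tabulate-cong P? Q? {zero}  f g h = refl
count-tabulate-cong P? Q? {suc ℓ} f g h rewrite h zero =
  cong (if does (Q? (g zero)) then suc else id)
       (count-tabulate-cong P? Q? (f ∘ suc) (g ∘ suc) (h ∘ suc))

-- Reading words off a list of letters.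

module _ {n : ℕ} (m r : Fin n → ℕ) where

  code : Letter m r → ColoredLetter
  code = ⟦_⟧ m r

  _≟ˡ_ : DecidableEquality (Letter m r)
  _≟ˡ_ = ≡-dec Fin._≟_ Fin._≟_

  code-injective : ∀ {x y} → code x ≡ code y → x ≡ y
  code-injective {k , c} {l , e} eq
    with refl ← Fin.toℕ-injective (ℕ.suc-injective (,-injectiveʳ eq))
    with refl ← Fin.toℕ-injective (ℕ.suc-injective (,-injectiveˡ eq)) = refl

  letters-complete : ∀ x → x ∈ letters m r
  letters-complete (k , c) = ∈-concatMap⁺ (λ k → List.map (k ,_) (List.allFin (r k)))
    (Any.map (λ { refl → ∈-map⁺ (k ,_) (∈-allFin c) }) (∈-allFin k))

  letters-unique : Unique (letters m r)
  letters-unique = Unique.concat⁺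
    (All.map⁺ (All.universal (λ k → Unique.map⁺ (λ { refl → refl }) (Unique.allFin⁺ (r k))) _))
    (AllPairs.map⁺ (AllPairs.map disjoint (Unique.allFin⁺ n)))
    where
    disjoint : ∀ {k l} → k ≢ l →
      Disjoint (List.map (k ,_) (List.allFin (r k))) (List.map (l ,_) (List.allFin (r l)))
    disjoint k≢l (x∈ , x∈′) with ∈-map⁻ _ x∈ | ∈-map⁻ _ x∈′
    ... | _ , _ , refl | _ , _ , refl = k≢l refl

  sumOver-letters : ∀ f → sumOver (letters m r) f ≡
    sumOver (List.allFin n) (λ k → sumOver (List.allFin (r k)) (λ c → f (k , c)))
  sumOver-letters f = trans
    (sumOver-concatMap (λ k → List.map (k ,_) (List.allFin (r k))) (List.allFin n) f)
    (sumOver-cong (List.allFin n) λ {k} _ → sumOver-map (k ,_) (List.allFin (r k)) f)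

  isLetter : Fin n → Letter m r → Bool
  isLetter k x = does (proj₁ x Fin.≟ k)

  multiplicity : Fin n → List (Letter m r) → ℕ
  multiplicity k xs = sumOver xs (𝟙 ∘ isLetter k)

  -- Length and content vary so that induction on words is possible. For content `m` and full length
  -- this unfolds to `IsMultisetPermutation`.
  HasContent : ∀ {ℓ} → (Fin n → ℕ) → Word m r ℓ → Set
  HasContent c w = ∀ k → count (λ x → proj₁ x Fin.≟ k) w ≡ c k

  hasContent? : ∀ {ℓ} c (w : Word m r ℓ) → Dec (HasContent c w)
  hasContent? c w = Fin.all? λ k → count (λ x → proj₁ x Fin.≟ k) w ℕ.≟ c k

  hasContent-∷-zero : ∀ {ℓ} c z (w : Word m r ℓ) → c (proj₁ z) ≡ 0 →
    does (hasContent? c (z ∷ w)) ≡ false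
  hasContent-∷-zero c z w ck≡0 = dec-false (hasContent? c (z ∷ w)) λ h → absurd (h (proj₁ z))
    where
    absurd : count (λ x → proj₁ x Fin.≟ proj₁ z) (z ∷ w) ≢ c (proj₁ z)
    absurd rewrite dec-true (proj₁ z Fin.≟ proj₁ z) refl | ck≡0 = λ ()

  -- `pred` truncates at 0, which is why the first letter must have a positive count here; count 0
  -- is left to `hasContent-∷-zero`.
  hasContent-∷-suc : ∀ {ℓ} c z (w : Word m r ℓ) {e} → c (proj₁ z) ≡ suc e →
    does (hasContent? c (z ∷ w)) ≡ does (hasContent? (updateAt c (proj₁ z) pred) w)
  hasContent-∷-suc c z w {e} ck≡ = does-⇔ (mk⇔ to from) (hasContent? c (z ∷ w)) (hasContent? c′ w)
    where
    c′ = updateAt c (proj₁ z) pred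

    to : HasContent c (z ∷ w) → HasContent c′ w
    to h k with proj₁ z Fin.≟ k | h k
    ... | yes refl | eq = trans (cong pred eq) (sym (updateAt-updates k c))
    ... | no  z≢k  | eq = trans eq (sym (updateAt-minimal k (proj₁ z) c (≢-sym z≢k)))

    from : HasContent c′ w → HasContent c (z ∷ w)
    from h k with proj₁ z Fin.≟ k | h k
    ... | yes refl | eq = trans (cong suc (trans eq (trans (updateAt-updates k c) (cong pred ck≡)))) (sym ck≡)
    ... | no  z≢k  | eq = trans eq (updateAt-minimal k (proj₁ z) c (≢-sym z≢k))

  -- The number of weakly (false) or strictly (true) increasing sequences of
  -- positions at which the word can be read in the list.
  readings : ∀ {ℓ} → Bool → Word m r ℓ → List (Letter m r) → ℕ
  readings b []      L       = 1
  readings b (x ∷ w) []      = 0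
  readings b (x ∷ w) (z ∷ L) =
    readings b (x ∷ w) L + (if does (x ≟ˡ z) then readings b w (if b then L else z ∷ L) else 0)

  -- Reading in a list amounts to choosing the positions of each letter k
  -- separately, whatever the order of the list.
  ∑-readings : ∀ b ℓ c L → sum (List.tabulate c) ≡ ℓ →
    sumOver (words m r ℓ) (λ w → if does (hasContent? c w) then readings b w L else 0) ≡
    ∏ (λ k → choose b (multiplicity k L) (c k))
  ∑-readings b zero c L Σc≡ℓ = trans
    (cong (λ d → (if d then 1 else 0) + 0) (dec-true (hasContent? {zero} c []) (sym ∘ c≗0)))
    (sym (∏-one λ k → cong (choose b (multiplicity k L)) (c≗0 k)))
    where
    c≗0 : ∀ k → c k ≡ 0
    c≗0 = sum-tabulate-zero⁻ Σc≡ℓ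
  ∑-readings b (suc ℓ) c [] Σc≡ℓ = trans
    (sumOver-zero (words m r (suc ℓ)) λ {w} _ → none w)
    (sym (∏-choose-zero b {c} (subst (_> 0) (sym Σc≡ℓ) z<s)))
    where
    none : (w : Word m r (suc ℓ)) → (if does (hasContent? c w) then readings b w [] else 0) ≡ 0
    none w@(_ ∷ _) with does (hasContent? c w)
    ... | true  = refl
    ... | false = refl
  ∑-readings b (suc ℓ) c (z ∷ L) Σc≡ℓ = begin
    sumOver (words m r (suc ℓ)) (λ w → if does (hasContent? c w) then readings b w (z ∷ L) else 0)
      ≡⟨ sumOver-cong (words m r (suc ℓ)) (λ {w} _ → split w) ⟩
    sumOver (words m r (suc ℓ)) (λ w → later w + now w)
      ≡⟨ sumOver-+ (words m r (suc ℓ)) later now ⟩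
    sumOver (words m r (suc ℓ)) later + sumOver (words m r (suc ℓ)) now
      ≡⟨ cong₂ _+_ (∑-readings b (suc ℓ) c L Σc≡ℓ) ∑-now ⟩
    ∏ (λ k → choose b (multiplicity k L) (c k)) +
    sumOver (words m r ℓ) (λ w → if does (hasContent? c (z ∷ w)) then readings b w L′ else 0)
      ≡⟨ combine (c k₀) refl ⟩
    ∏ (λ k → choose b (multiplicity k (z ∷ L)) (c k)) ∎
    where
    open ≡-Reasoning

    k₀ = proj₁ z
    c′ = updateAt c k₀ pred
    L′ = if b then L else z ∷ L

    -- `now` collects the readings whose first position is that of `z`, `later` the others. Only
    -- words beginning with `z` contribute to `now`.
    later now : Word m r (suc ℓ) → ℕ
    later w         = if does (hasContent? c w) then readings b w L else 0
    now   w@(x ∷ v) = if does (hasContent? c w) then (if does (x ≟ˡ z) then readings b v L′ else 0) else 0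

    split : ∀ w → (if does (hasContent? c w) then readings b w (z ∷ L) else 0) ≡ later w + now w
    split w@(_ ∷ _) with does (hasContent? c w)
    ... | true  = refl
    ... | false = refl

    now-≢ : ∀ {x} → x ≢ z → ∀ w → now (x ∷ w) ≡ 0
    now-≢ {x} x≢z w rewrite dec-false (x ≟ˡ z) x≢z with does (hasContent? c (x ∷ w))
    ... | true  = refl
    ... | false = refl

    ∑-now : sumOver (words m r (suc ℓ)) now ≡
      sumOver (words m r ℓ) (λ w → if does (hasContent? c (z ∷ w)) then readings b w L′ else 0)
    ∑-now = begin
      sumOver (words m r (suc ℓ)) now
        ≡⟨ sumOver-cartesianProductWith _∷_ (letters m r) (words m r ℓ) now ⟩
      sumOver (letters m r) (λ x → sumOver (words m r ℓ) (λ w → now (x ∷ w)))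
        ≡⟨ sumOver-single _ letters-unique (letters-complete z)
             (λ x≢z → sumOver-zero (words m r ℓ) λ {w} _ → now-≢ x≢z w) ⟩
      sumOver (words m r ℓ) (λ w → now (z ∷ w))
        ≡⟨ sumOver-cong (words m r ℓ) (λ {w} _ →
             cong (λ d → if does (hasContent? c (z ∷ w)) then (if d then readings b w L′ else 0) else 0)
                  (dec-true (z ≟ˡ z) refl)) ⟩
      sumOver (words m r ℓ) (λ w → if does (hasContent? c (z ∷ w)) then readings b w L′ else 0) ∎

    multiplicity-≢ : ∀ {k} → k ≢ k₀ → multiplicity k (z ∷ L) ≡ multiplicity k L
    multiplicity-≢ {k} k≢ rewrite dec-false (k₀ Fin.≟ k) (≢-sym k≢) = refl

    multiplicity-≡ : multiplicity k₀ (z ∷ L) ≡ suc (multiplicity k₀ L)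
    multiplicity-≡ rewrite dec-true (k₀ Fin.≟ k₀) refl = refl

    multiplicity′-≢ : ∀ b {k} → k ≢ k₀ → multiplicity k (if b then L else z ∷ L) ≡ multiplicity k L
    multiplicity′-≢ true  k≢ = refl
    multiplicity′-≢ false k≢ = multiplicity-≢ k≢

    multiplicity′-≡ : ∀ b → multiplicity k₀ (if b then L else z ∷ L) ≡
      (if b then multiplicity k₀ L else suc (multiplicity k₀ L))
    multiplicity′-≡ true  = refl
    multiplicity′-≡ false = multiplicity-≡

    -- If the content excludes `k₀`, the sum vanishes and `choose b _ 0 = 1` ignores the extra copy
    -- of `k₀`. Otherwise this is the recursion of `choose` in the factor at `k₀`.
    combine : ∀ e → c k₀ ≡ e →
      ∏ (λ k → choose b (multiplicity k L) (c k)) +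
      sumOver (words m r ℓ) (λ w → if does (hasContent? c (z ∷ w)) then readings b w L′ else 0)
      ≡ ∏ (λ k → choose b (multiplicity k (z ∷ L)) (c k))
    combine zero ck≡ = trans
      (cong₂ _+_ (∏-cong same) (sumOver-zero (words m r ℓ) λ {w} _ →
        cong (λ d → if d then readings b w L′ else 0) (hasContent-∷-zero c z w ck≡)))
      (ℕ.+-identityʳ _)
      where
      same : ∀ k → choose b (multiplicity k L) (c k) ≡ choose b (multiplicity k (z ∷ L)) (c k)
      same k with k Fin.≟ k₀
      ... | yes refl rewrite ck≡ = refl
      ... | no  k≢               = cong (λ a → choose b a (c k)) (sym (multiplicity-≢ k≢))
    combine (suc e) ck≡ = trans
      (cong (∏ (λ k → choose b (multiplicity k L) (c k)) +_) (trans
        (sumOver-cong (words m r ℓ) λ {w} _ →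
          cong (λ d → if d then readings b w L′ else 0) (hasContent-∷-suc c z w ck≡))
        -- The recursion is on the word length: in the weak case `L′` is `z ∷ L` again.
        (∑-readings b ℓ c′ L′ (ℕ.suc-injective (trans (sym Σc≡) Σc≡ℓ)))))
      (sym (∏-+ k₀ at-k₀ λ k k≢ →
        cong (λ a → choose b a (c k)) (multiplicity-≢ k≢) ,
        cong₂ (choose b) (trans (multiplicity-≢ k≢) (sym (multiplicity′-≢ b k≢)))
                         (sym (updateAt-minimal k k₀ c k≢))))
      where
      c′k≡ : c′ k₀ ≡ e
      c′k≡ = trans (updateAt-updates k₀ c) (cong pred ck≡)

      Σc≡ : sum (List.tabulate c) ≡ suc (sum (List.tabulate c′))
      Σc≡ = sum-tabulate-suc k₀ (trans ck≡ (cong suc (sym c′k≡)))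
              λ k k≢ → sym (updateAt-minimal k k₀ c k≢)

      at-k₀ : choose b (multiplicity k₀ (z ∷ L)) (c k₀) ≡
              choose b (multiplicity k₀ L) (c k₀) + choose b (multiplicity k₀ L′) (c′ k₀)
      at-k₀ rewrite c′k≡ | ck≡ | multiplicity-≡ | multiplicity′-≡ b = refl

-- Readings of a single word in repeated blocks of letters.

module Blocks {n : ℕ} (m r : Fin n → ℕ) (b : Bool) {_⊏_ : Rel ColoredLetter 0ℓ}
  (isSTO : IsStrictTotalOrder _≡_ _⊏_) (_⊏?_ : Decidable _⊏_) where

  open IsStrictTotalOrder isSTO using (compare; irrefl; asym) renaming (trans to ⊏-trans)
  open DecMembership (_≟ˡ_ m r) using (_∈?_)

  -- Whether y cannot be read after x within one ⊏-increasing list, positions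
  -- having to increase weakly (false) or strictly (true).
  breakBetween : Bool → ColoredLetter → ColoredLetter → Bool
  breakBetween true  x y = not (does (x ⊏? y))
  breakBetween false x y = does (y ⊏? x)

  brk : ColoredLetter → ColoredLetter → Bool
  brk = breakBetween b

  ∞ : ColoredLetter
  ∞ = 1 , suc n

  -- Each break forces a reading into the next block. The last letter is compared with `∞`, the head
  -- of `extend m r []`.
  breaks : ∀ {ℓ} → Word m r ℓ → ℕ
  breaks []      = 0
  breaks (x ∷ w) = 𝟙 (brk (code m r x) (Vec.head (extend m r w))) + breaks w

  ⊏⇒brk : ∀ b {x y} → x ⊏ y → breakBetween b x y ≡ false
  ⊏⇒brk true  {x} {y} x⊏y = cong not (dec-true (x ⊏? y) x⊏y)
  ⊏⇒brk false {x} {y} x⊏y = dec-false (y ⊏? x) (asym x⊏y)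

  ⊐⇒brk : ∀ b {x y} → y ⊏ x → breakBetween b x y ≡ true
  ⊐⇒brk true  {x} {y} y⊏x = cong not (dec-false (x ⊏? y) (asym y⊏x))
  ⊐⇒brk false {x} {y} y⊏x = dec-true (y ⊏? x) y⊏x

  brk-refl : ∀ b x → breakBetween b x x ≡ b
  brk-refl true  x = cong not (dec-false (x ⊏? x) (irrefl refl))
  brk-refl false x = dec-false (x ⊏? x) (irrefl refl)

  -- For fixed `x`, the letters that can follow `x` without a break form an up-set of `⊏`, with or
  -- without `x` itself; any letter outside it lies below all of it.
  brk-⊏ : ∀ b {x y z} → breakBetween b x y ≡ false → breakBetween b x z ≡ true → z ⊏ y
  brk-⊏ b {x} {y} {z} xy xz with compare z y
  ... | tri< z⊏y _ _ = z⊏y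
  ... | tri≈ _ refl _ = contradiction (trans (sym xy) xz) λ ()
  ... | tri> _ _ y⊏z with compare x y
  ...   | tri< x⊏y _ _  = contradiction (trans (sym (⊏⇒brk b (⊏-trans x⊏y y⊏z))) xz) λ ()
  ...   | tri≈ _ refl _ = contradiction (trans (sym (⊏⇒brk b y⊏z)) xz) λ ()
  ...   | tri> _ _ y⊏x  = contradiction (trans (sym xy) (⊐⇒brk b y⊏x)) λ ()

  -- Dually, the letters that can precede a fixed `z` without a break form a down-set.
  brk-⊏′ : ∀ b {x y z} → breakBetween b x z ≡ false → breakBetween b y z ≡ true → x ⊏ y
  brk-⊏′ b {x} {y} {z} xz yz with compare x y
  ... | tri< x⊏y _ _ = x⊏y
  ... | tri≈ _ refl _ = contradiction (trans (sym xz) yz) λ ()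
  ... | tri> _ _ y⊏x with compare y z
  ...   | tri< y⊏z _ _  = contradiction (trans (sym (⊏⇒brk b y⊏z)) yz) λ ()
  ...   | tri≈ _ refl _ = contradiction (trans (sym xz) (⊐⇒brk b y⊏x)) λ ()
  ...   | tri> _ _ z⊏y  = contradiction (trans (sym xz) (⊐⇒brk b (⊏-trans z⊏y y⊏x))) λ ()

  brk-trans : ∀ {x y z} → brk x y ≡ false → brk x z ≡ true → brk y z ≡ true
  brk-trans xy xz = ⊐⇒brk b (brk-⊏ b xy xz)

  -- As long as no break occurs, `brk-trans` hands the break against `∞` on to the next letter; at
  -- the end of the word it is counted.
  breaks>0 : ∀ {ℓ} x (w : Word m r ℓ) → brk (code m r x) ∞ ≡ true → breaks (x ∷ w) > 0
  breaks>0 x []      x∞ rewrite x∞ = z<s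
  breaks>0 x (y ∷ w) x∞ with brk (code m r x) (code m r y) in xy
  ... | true  = z<s
  ... | false = breaks>0 y w (brk-trans xy x∞)

  Increasing : List (Letter m r) → Set
  Increasing = AllPairs (λ x y → code m r x ⊏ code m r y)

  -- What remains of the increasing list of all letters after some letters
  -- have been passed.
  Remainder : List (Letter m r) → Set
  Remainder s = Increasing s × (∀ x → x ∈ s ⊎ All (λ y → code m r x ⊏ code m r y) s)

  remainder-tail : ∀ {z s} → Remainder (z ∷ s) → Remainder s
  remainder-tail {z} {s} (z< ∷ inc , covered) = inc , covered′
    where
    covered′ : ∀ x → x ∈ s ⊎ All (λ y → code m r x ⊏ code m r y) s
    covered′ x with covered x
    ... | inj₁ (here refl) = inj₂ z<
    ... | inj₁ (there x∈)  = inj₁ x∈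
    ... | inj₂ (_ ∷ x<)    = inj₂ x<

  passed : List (Letter m r) → Letter m r → Bool
  passed s x = does (¬? (x ∈? s))

  ∈⇒passed : ∀ {x s} → x ∈ s → passed s x ≡ false
  ∈⇒passed {x} {s} x∈ = dec-false (¬? (x ∈? s)) λ x∉ → x∉ x∈

  ∉⇒passed : ∀ {x s} → ¬ x ∈ s → passed s x ≡ true
  ∉⇒passed {x} {s} x∉ = dec-true (¬? (x ∈? s)) x∉

  ⊏-all⇒∉ : ∀ {x s} → All (λ y → code m r x ⊏ code m r y) s → ¬ x ∈ s
  ⊏-all⇒∉ x< x∈ = irrefl refl (All.lookup x< x∈)

  -- After `z`, a strict reading continues in `s` and a weak one in `z ∷ s`. This translates breaks
  -- in the word into letters passed in the list.
  brk-passed : ∀ b′ {z s} → Remainder (z ∷ s) → ∀ x →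
    breakBetween b′ (code m r z) (code m r x) ≡ passed (if b′ then s else z ∷ s) x
  brk-passed b′ {z} {s} (z< ∷ inc , covered) x with covered x
  brk-passed true {z} {s} (z< ∷ inc , covered) x | inj₁ (here refl) =
    trans (brk-refl true (code m r z)) (sym (∉⇒passed (⊏-all⇒∉ z<)))
  brk-passed false {z} {s} (z< ∷ inc , covered) x | inj₁ (here refl) =
    trans (brk-refl false (code m r z)) (sym (∈⇒passed {s = z ∷ s} (here refl)))
  brk-passed true  (z< ∷ inc , covered) x | inj₁ (there x∈) =
    trans (⊏⇒brk true (All.lookup z< x∈)) (sym (∈⇒passed x∈))
  brk-passed false {z} {s} (z< ∷ inc , covered) x | inj₁ (there x∈) =
    trans (⊏⇒brk false (All.lookup z< x∈)) (sym (∈⇒passed {s = z ∷ s} (there x∈)))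
  brk-passed true  (z< ∷ inc , covered) x | inj₂ (x⊏z ∷ x<) =
    trans (⊐⇒brk true x⊏z) (sym (∉⇒passed (⊏-all⇒∉ x<)))
  brk-passed false {z} {s} (z< ∷ inc , covered) x | inj₂ x< =
    trans (⊐⇒brk false (All.head x<)) (sym (∉⇒passed (⊏-all⇒∉ x<)))

  headPassed : ∀ {ℓ} → List (Letter m r) → Word m r ℓ → Bool
  headPassed s []      = false
  headPassed s (x ∷ w) = passed s x

  -- The number of readings of w in s followed by u blocks, the last of them
  -- incomplete.  If u = 0, it is s itself that is cut off at ∞.
  expected : ∀ {ℓ} → List (Letter m r) → ℕ → Word m r ℓ → ℕ
  expected {ℓ} s u w = (u + ℓ ∸ (𝟙 (headPassed s w) + breaks w)) C ℓ

  -- If `u` is 0, the list is cut off at `∞`, so its letters must not break against `∞`. For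
  -- one-letter words this is the bound that Pascal's rule needs.
  MayPrecede : ℕ → Letter m r → Set
  MayPrecede u z = u > 0 ⊎ brk (code m r z) ∞ ≡ false

  -- The new position matters only to words beginning with `z`. Their readings avoid it, or start
  -- there and continue in `L` or, weakly, in `z ∷ L`; Pascal's rule adds the two counts.
  readings-∷ : ∀ {z s L u} → Remainder (z ∷ s) → MayPrecede u z →
    (∀ {ℓ} (w : Word m r ℓ) → readings m r b w L ≡ expected s u w) →
    ∀ {ℓ} (w : Word m r ℓ) → readings m r b w (z ∷ L) ≡ expected (z ∷ s) u w
  readings-∷ rem pre ih [] = refl
  readings-∷ {z} {s} {L} {u} rem pre ih {suc ℓ} (x ∷ w) = go x (_≟ˡ_ m r x z)
    where
    open ≡-Reasoning

    β = breaks (z ∷ w)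

    same : ∀ {x} → x ≢ z → Dec (x ∈ s) → passed s x ≡ passed (z ∷ s) x
    same x≢z (yes x∈) = trans (∈⇒passed x∈) (sym (∈⇒passed {s = z ∷ s} (there x∈)))
    same x≢z (no  x∉) = trans (∉⇒passed x∉)
      (sym (∉⇒passed {s = z ∷ s} λ { (here x≡z) → x≢z x≡z ; (there x∈) → x∉ x∈ }))

    ih′ : ∀ b′ → b ≡ b′ → ∀ {ℓ} (w : Word m r ℓ) →
      readings m r b w (if b′ then L else z ∷ L) ≡ expected (if b′ then s else z ∷ s) u w
    ih′ true  _ = ih
    ih′ false _ = readings-∷ rem pre ih

    -- The head term of `expected` turns into the first term of `breaks (z ∷ w)`.
    next : ∀ {ℓ} (w : Word m r ℓ) →
      readings m r b w (if b then L else z ∷ L) ≡ (u + ℓ ∸ breaks (z ∷ w)) C ℓ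
    next []             = refl
    next {ℓ} w@(y ∷ w′) = trans (ih′ b refl w)
      (cong (λ p → (u + ℓ ∸ (𝟙 p + breaks w)) C ℓ) (sym (brk-passed b rem y)))

    side : ∀ {ℓ} (w : Word m r ℓ) → breaks (z ∷ w) ≤ u + ℓ ⊎ ℓ > 0
    side (_ ∷ _) = inj₂ z<s
    side []      = inj₁ (≤-side pre)
      where
      ≤-side : MayPrecede u z → 𝟙 (brk (code m r z) ∞) + 0 ≤ u + 0
      ≤-side (inj₁ u>0) = ℕ.+-monoˡ-≤ 0 (ℕ.≤-trans (𝟙≤1 _) u>0)
        where
        𝟙≤1 : ∀ d → 𝟙 d ≤ 1
        𝟙≤1 true  = ℕ.≤-refl
        𝟙≤1 false = z≤n
      ≤-side (inj₂ z∞) rewrite z∞ = z≤n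

    go : ∀ x (d : Dec (x ≡ z)) → readings m r b (x ∷ w) L +
      (if does d then readings m r b w (if b then L else z ∷ L) else 0) ≡ expected (z ∷ s) u (x ∷ w)
    go x (no x≢z) = trans (ℕ.+-identityʳ _) (trans (ih (x ∷ w))
      (cong (λ p → (u + suc ℓ ∸ (𝟙 p + breaks (x ∷ w))) C suc ℓ) (same x≢z (x ∈? s))))
    go x (yes refl) = begin
      readings m r b (z ∷ w) L + readings m r b w (if b then L else z ∷ L)
        ≡⟨ cong₂ _+_ (ih (z ∷ w)) (next w) ⟩
      (u + suc ℓ ∸ (𝟙 (passed s z) + β)) C suc ℓ + (u + ℓ ∸ β) C ℓ
        ≡⟨ cong₂ (λ p a → (a ∸ (𝟙 p + β)) C suc ℓ + (u + ℓ ∸ β) C ℓ)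
             -- `z` itself is passed in `s`; the 1 subtracted for this cancels the `suc` of `suc ℓ`.
             (∉⇒passed (⊏-all⇒∉ (AllPairs.head (proj₁ rem)))) (ℕ.+-suc u ℓ) ⟩
      (u + ℓ ∸ β) C suc ℓ + (u + ℓ ∸ β) C ℓ
        ≡⟨ pascal-∸ (u + ℓ) β ℓ (side w) ⟨
      (suc (u + ℓ) ∸ β) C suc ℓ
        ≡⟨ cong₂ (λ p a → (a ∸ (𝟙 p + β)) C suc ℓ) (sym (∈⇒passed {s = z ∷ s} (here refl)))
             (sym (ℕ.+-suc u ℓ)) ⟩
      expected (z ∷ s) u (z ∷ w) ∎

  -- `L` is the actual rest of the list, `q` only the rest of the current increasing list. Thus `L`
  -- may hold further blocks, or be empty at the cut.
  readings-++ : ∀ s {q L u} → Remainder (s ++ q) → All (MayPrecede u) s →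
    (∀ {ℓ} (w : Word m r ℓ) → readings m r b w L ≡ expected q u w) →
    ∀ {ℓ} (w : Word m r ℓ) → readings m r b w (s ++ L) ≡ expected (s ++ q) u w
  readings-++ []      rem pre         ih = ih
  readings-++ (z ∷ s) rem (pz ∷ pre) ih =
    readings-∷ rem pz (readings-++ s (remainder-tail rem) pre ih)

  letterOrder : StrictTotalOrder 0ℓ 0ℓ 0ℓ
  letterOrder = On.strictTotalOrder (record { isStrictTotalOrder = isSTO }) (code m r)

  open StrictTotalOrderProperties letterOrder using (decTotalOrder)

  sorted : List (Letter m r)
  sorted = Sort.sort decTotalOrder (letters m r)

  sorted-↭ : sorted ↭ letters m r
  sorted-↭ = Sort.sort-↭ decTotalOrder (letters m r)

  sorted-complete : ∀ x → x ∈ sorted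
  sorted-complete x = ∈-resp-↭ (↭-sym sorted-↭) (letters-complete m r x)

  sorted-increasing : Increasing sorted
  sorted-increasing = AllPairs.zipWith strict
    ( Sorted⇒AllPairs (DecTotalOrder.totalOrder decTotalOrder) (Sort.sort-↗ decTotalOrder (letters m r))
    , Permutation.Unique-resp-↭ (setoid (Letter m r)) (↭⇒↭ₛ (↭-sym sorted-↭)) (letters-unique m r))
    where
    strict : ∀ {x y} → (code m r x ⊏ code m r y ⊎ code m r x ≡ code m r y) × x ≢ y →
      code m r x ⊏ code m r y
    strict (inj₁ x⊏y , _)   = x⊏y
    strict (inj₂ x≡y , x≢y) = contradiction (code-injective m r x≡y) x≢y

  initial? : ∀ x → Dec (brk (code m r x) ∞ ≡ false)
  initial? x = brk (code m r x) ∞ Bool.≟ false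

  -- Splitting the sorted list at `∞` makes the cut-off block literally a prefix of `block`.
  initial final block : List (Letter m r)
  initial = filter initial? sorted
  final   = filter (¬? ∘ initial?) sorted
  block   = initial ++ final

  initial-brk : All (λ x → brk (code m r x) ∞ ≡ false) initial
  initial-brk = All.all-filter initial? sorted

  final-brk : All (λ x → brk (code m r x) ∞ ≡ true) final
  final-brk = All.map Bool.¬-not (All.all-filter (¬? ∘ initial?) sorted)

  block-complete : ∀ x → x ∈ block
  block-complete x with initial? x
  ... | yes p = ∈-++⁺ˡ (∈-filter⁺ initial? (sorted-complete x) p)
  ... | no ¬p = ∈-++⁺ʳ initial (∈-filter⁺ (¬? ∘ initial?) (sorted-complete x) ¬p)

  -- By `brk-⊏′`, letters without a break against `∞` lie below those with one, so the concatenation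
  -- is still increasing.
  block-remainder : Remainder block
  block-remainder = AllPairs.++⁺
    (AllPairs.filter⁺ initial? sorted-increasing)
    (AllPairs.filter⁺ (¬? ∘ initial?) sorted-increasing)
    (All.map (λ x∞ → All.map (brk-⊏′ b x∞) final-brk) initial-brk)
    , inj₁ ∘ block-complete

  -- At the cut, the letters of `final` are not yet passed although no position is left. The first
  -- letter of a nonempty word is passed or, being in `final`, leads to a break, so the binomial
  -- coefficient vanishes.
  readings-[] : ∀ {ℓ} (w : Word m r ℓ) → readings m r b w [] ≡ expected final 0 w
  readings-[] []              = refl
  readings-[] {suc ℓ} (x ∷ w) = none _ (positive (x ∈? final))
    where
    positive : Dec (x ∈ final) → 𝟙 (passed final x) + breaks (x ∷ w) > 0
    positive (yes x∈) = ℕ.m≤n⇒m≤o+n (𝟙 (passed final x)) (breaks>0 x w (All.lookup final-brk x∈))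
    positive (no  x∉) rewrite ∉⇒passed x∉ = z<s

    none : ∀ β → β > 0 → 0 ≡ (suc ℓ ∸ β) C suc ℓ
    none (suc β) _ = sym (k>n⇒nCk≡0 (s≤s (ℕ.m∸n≤m ℓ β)))

  blocks : ℕ → List (Letter m r)
  blocks zero    = initial
  blocks (suc t) = block ++ blocks t

  readings-blocks-expected : ∀ t {ℓ} (w : Word m r ℓ) →
    readings m r b w (blocks t) ≡ expected block t w
  readings-blocks-expected zero w =
    trans (cong (readings m r b w) (sym (++-identityʳ initial)))
          (readings-++ initial block-remainder (All.map inj₂ initial-brk) readings-[] w)
  readings-blocks-expected (suc t) w =
    trans (readings-++ block (subst Remainder (sym (++-identityʳ block)) block-remainder)
                       (All.universal (λ _ → inj₁ z<s) block) wrap w)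
          (cong (λ s → expected s (suc t) w) (++-identityʳ block))
    where
    -- At the end of a block every letter is passed. The 1 subtracted for this is made up for by the
    -- one additional block in `suc t`.
    wrap : ∀ {ℓ} (w : Word m r ℓ) → readings m r b w (blocks t) ≡ expected [] (suc t) w
    wrap []              = readings-blocks-expected t []
    wrap {suc ℓ} (x ∷ w) = trans (readings-blocks-expected t (x ∷ w))
      (cong (λ p → (t + suc ℓ ∸ (𝟙 p + breaks (x ∷ w))) C suc ℓ) (∈⇒passed (block-complete x)))

  readings-blocks : ∀ t {ℓ} (w : Word m r ℓ) →
    readings m r b w (blocks t) ≡ (t + ℓ ∸ breaks w) C ℓ
  readings-blocks t []              = readings-blocks-expected t []
  readings-blocks t {suc ℓ} (x ∷ w) = trans (readings-blocks-expected t (x ∷ w))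
    (cong (λ p → (t + suc ℓ ∸ (𝟙 p + breaks (x ∷ w))) C suc ℓ) (∈⇒passed (block-complete x)))

  multiplicity-letters : ∀ k → multiplicity m r k (letters m r) ≡ r k
  multiplicity-letters k = begin
    multiplicity m r k (letters m r)
      ≡⟨ sumOver-letters m r _ ⟩
    sumOver (List.allFin n) (λ l → sumOver (List.allFin (r l)) (λ _ → 𝟙 (does (l Fin.≟ k))))
      ≡⟨ sumOver-single _ (Unique.allFin⁺ n) (∈-allFin k) (λ {l} l≢k →
           sumOver-zero (List.allFin (r l)) λ _ → cong 𝟙 (dec-false (l Fin.≟ k) l≢k)) ⟩
    sumOver (List.allFin (r k)) (λ _ → 𝟙 (does (k Fin.≟ k)))
      ≡⟨ sumOver-cong (List.allFin (r k)) (λ _ → cong 𝟙 (dec-true (k Fin.≟ k) refl)) ⟩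
    sumOver (List.allFin (r k)) (λ _ → 1)
      ≡⟨ sumOver-one (List.allFin (r k)) ⟩
    List.length (List.allFin (r k))
      ≡⟨ length-tabulate id ⟩
    r k ∎
    where open ≡-Reasoning

  multiplicity-block : ∀ k → multiplicity m r k block ≡ r k
  multiplicity-block k = begin
    multiplicity m r k (initial ++ final)
      ≡⟨ sumOver-++ initial final _ ⟩
    multiplicity m r k initial + multiplicity m r k final
      ≡⟨ sumOver-partition initial? sorted _ ⟩
    multiplicity m r k sorted
      ≡⟨ sum-↭ (map⁺ _ sorted-↭) ⟩
    multiplicity m r k (letters m r)
      ≡⟨ multiplicity-letters k ⟩
    r k ∎
    where open ≡-Reasoning

  multiplicity-blocks : ∀ t k → multiplicity m r k (blocks t) ≡ t * r k + multiplicity m r k initial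
  multiplicity-blocks zero    k = refl
  multiplicity-blocks (suc t) k = begin
    multiplicity m r k (block ++ blocks t)
      ≡⟨ sumOver-++ block (blocks t) _ ⟩
    multiplicity m r k block + multiplicity m r k (blocks t)
      ≡⟨ cong₂ _+_ (multiplicity-block k) (multiplicity-blocks t k) ⟩
    r k + (t * r k + multiplicity m r k initial)
      ≡⟨ ℕ.+-assoc (r k) (t * r k) _ ⟨
    suc t * r k + multiplicity m r k initial ∎
    where open ≡-Reasoning

  -- Double count of the pairs of a multiset permutation and one of its readings in `blocks t`.
  ∑-words-C : ∀ t → sumOver (𝔖 m r) (λ w → (t + ∣𝐦∣ m r ∸ breaks w) C ∣𝐦∣ m r) ≡
    ∏ (λ k → choose b (t * r k + multiplicity m r k initial) (m k))
  ∑-words-C t = begin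
    sumOver (𝔖 m r) (λ w → (t + ∣𝐦∣ m r ∸ breaks w) C ∣𝐦∣ m r)
      ≡⟨ sumOver-cong (𝔖 m r) (λ {w} _ → sym (readings-blocks t w)) ⟩
    sumOver (𝔖 m r) (λ w → readings m r b w (blocks t))
      ≡⟨ sumOver-filter (isMultisetPermutation? m r) (words m r (∣𝐦∣ m r)) _ ⟩
    sumOver (words m r (∣𝐦∣ m r)) (λ w →
      if does (hasContent? m r m w) then readings m r b w (blocks t) else 0)
      ≡⟨ ∑-readings m r b (∣𝐦∣ m r) m (blocks t) refl ⟩
    ∏ (λ k → choose b (multiplicity m r k (blocks t)) (m k))
      ≡⟨ ∏-cong (λ k → cong (λ a → choose b a (m k)) (multiplicity-blocks t k)) ⟩
    ∏ (λ k → choose b (t * r k + multiplicity m r k initial) (m k)) ∎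
    where open ≡-Reasoning

-- The order on colored letters, ceilings and maxima.

≺-isStrictTotalOrder : IsStrictTotalOrder _≡_ _≺_
≺-isStrictTotalOrder = isStrictTotalOrderᶜ record
  { isEquivalence = isEquivalence
  ; trans         = ×-transitive {_<₂_ = _<_} isEquivalence (resp₂ _<_) ℕ.<-trans ℕ.<-trans
  ; compare       = ≺-compare
  }
  where
  ≺-compare : Trichotomous _≡_ _≺_
  ≺-compare x y with ×-compare sym ℕ.<-cmp ℕ.<-cmp x y
  ... | tri< x≺y x≢y x⊁y         = tri< x≺y (λ { refl → x≢y (refl , refl) }) x⊁y
  ... | tri≈ x⊀y (refl , refl) x⊁y = tri≈ x⊀y refl x⊁y
  ... | tri> x⊀y x≢y x≻y         = tri> x⊀y (λ { refl → x≢y (refl , refl) }) x≻y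

lookup-zero : ∀ {A : Set} {ℓ} (xs : Vec A (suc ℓ)) → lookup xs zero ≡ Vec.head xs
lookup-zero (x ∷ xs) = refl

-- Division of a negative integer branches on the remainder, which is 0 here. Keeping `x` apart from
-- `a * d` allows the split into zero and nonzero dividend.
-[a*d]/d : ∀ a d .{{_ : NonZero d}} {x} → x ≡ a * d → ℤ.- (ℤ.+ x) ℤ./ℕ d ≡ ℤ.- (ℤ.+ a)
-[a*d]/d a d {zero}  eq = trans (cong ℤ.+_ (ℕ.0/n≡0 d))
  (cong (λ e → ℤ.- (ℤ.+ e)) (sym (ℕ.m*n≡0⇒m≡0 a d (sym eq))))
-[a*d]/d a d {suc p} eq with suc p ℕ.% d | trans (cong (ℕ._% d) eq) (ℕ.m*n%n≡0 a d)
... | zero | _ = cong (λ e → ℤ.- (ℤ.+ e)) (trans (cong (ℕ._/ d) eq) (ℕ.m*n/n≡m a d))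

ceiling-* : ∀ a d .{{_ : NonZero d}} → ∣ ceiling (ℤ.+ (a * d) / d) ∣ ≡ a
ceiling-* a d@(suc _) = cong ∣_∣ (begin
  ℤ.- (ℤ.- (ℤ.+ (a * d)) ℤ./ (ℤ.+ d)) ≡⟨ cong ℤ.-_ (div-pos-is-/ℕ (ℤ.- (ℤ.+ (a * d))) d) ⟩
  ℤ.- (ℤ.- (ℤ.+ (a * d)) ℤ./ℕ d)      ≡⟨ cong ℤ.-_ (-[a*d]/d a d refl) ⟩
  ℤ.- (ℤ.- (ℤ.+ a))                   ≡⟨ neg-involutive (ℤ.+ a) ⟩
  ℤ.+ a                               ∎)
  where open ≡-Reasoning

max-const : ∀ {n} a {f : Fin n → ℕ} → Fin n → (∀ k → f k ≡ a) → max 0 (List.tabulate f) ≡ a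
max-const a {f} k₀ f≗a = ℕ.≤-antisym
  (max≤v⁺ z≤n (All.tabulate⁺ λ k → ℕ.≤-reflexive (f≗a k)))
  (v≤max⁺ 0 (List.tabulate f) (inj₂ (Any.tabulate⁺ k₀ (ℕ.≤-reflexive (sym (f≗a k₀))))))

-- The two Worpitzky-type identities.

module _ {n : ℕ} (m r : Fin n → ℕ) where

  module Weak   = Blocks m r false ≺-isStrictTotalOrder _≺?_
  -- Flipping the order makes the list of letters decreasing and the breaks exactly the
  -- non-descents.
  module Strict = Blocks m r true (Flip.isStrictTotalOrder ≺-isStrictTotalOrder) (λ x y → y ≺? x)

  des≡breaks : ∀ {ℓ} (w : Word m r ℓ) → des m r w ≡ Weak.breaks w
  des≡breaks []              = refl
  des≡breaks {suc ℓ} (x ∷ w) = begin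
    (if does (descent? m r (x ∷ w) zero) then suc else id) (count (descent? m r (x ∷ w)) (Vec.tabulate suc))
      ≡⟨ if-suc (does (descent? m r (x ∷ w) zero)) ⟩
    𝟙 (does (descent? m r (x ∷ w) zero)) + count (descent? m r (x ∷ w)) (Vec.tabulate suc)
      ≡⟨ cong₂ (λ y e → 𝟙 (does (y ≺? code m r x)) + e) (lookup-zero (extend m r w))
           (count-tabulate-cong (descent? m r (x ∷ w)) (descent? m r w) suc id λ _ → refl) ⟩
    𝟙 (does (Vec.head (extend m r w) ≺? code m r x)) + des m r w
      ≡⟨ cong (𝟙 (does (Vec.head (extend m r w) ≺? code m r x)) +_) (des≡breaks w) ⟩
    Weak.breaks (x ∷ w) ∎
    where
    open ≡-Reasoning
    if-suc : ∀ d {e} → (if d then suc else id) e ≡ 𝟙 d + e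
    if-suc true  = refl
    if-suc false = refl

  breaks+des : ∀ {ℓ} (w : Word m r ℓ) → Strict.breaks w + des m r w ≡ ℓ
  breaks+des w = trans (cong (Strict.breaks w +_) (des≡breaks w)) (complementary w)
    where
    𝟙-not : ∀ d {e e′} → 𝟙 (not d) + e + (𝟙 d + e′) ≡ suc (e + e′)
    𝟙-not true  = ℕ.+-suc _ _
    𝟙-not false = refl

    complementary : ∀ {ℓ} (w : Word m r ℓ) → Strict.breaks w + Weak.breaks w ≡ ℓ
    complementary []      = refl
    complementary (x ∷ w) = trans
      (𝟙-not (does (Vec.head (extend m r w) ≺? code m r x)) {Strict.breaks w})
      (cong suc (complementary w))

  des≤ℓ : ∀ {ℓ} (w : Word m r ℓ) → des m r w ≤ ℓ
  des≤ℓ w = subst (des m r w ≤_) (breaks+des w) (ℕ.m≤n+m (des m r w) (Strict.breaks w))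

  -- Only the copy of `k` of the first color passes the filter. `P` is abstract in order to cover
  -- both the initial letters of `Weak` and the final letters of `Strict`.
  multiplicity-color-one : ∀ {P : Letter m r → Set} (P? : ∀ x → Dec (P x)) →
    (∀ x → P x ⇔ toℕ (proj₂ x) ≡ 0) → ∀ {xs} → xs ↭ letters m r → ∀ k → r k > 0 →
    multiplicity m r k (filter P? xs) ≡ 1
  multiplicity-color-one {P} P? P⇔ {xs} xs↭ k rk>0 = begin
    multiplicity m r k (filter P? xs)
      ≡⟨ sumOver-filter P? xs _ ⟩
    sumOver xs indicator
      ≡⟨ sum-↭ (map⁺ indicator xs↭) ⟩
    sumOver (letters m r) indicator
      ≡⟨ sumOver-letters m r indicator ⟩
    sumOver (List.allFin n) (λ l → sumOver (List.allFin (r l)) (λ c → indicator (l , c)))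
      ≡⟨ sumOver-single _ (Unique.allFin⁺ n) (∈-allFin k) (λ {l} l≢k →
           sumOver-zero (List.allFin (r l)) λ {c} _ → off-letter l≢k c) ⟩
    sumOver (List.allFin (r k)) (λ c → indicator (k , c))
      ≡⟨ sumOver-single _ (Unique.allFin⁺ (r k)) (∈-allFin c₀) off-color ⟩
    indicator (k , c₀)
      ≡⟨ cong₂ (λ d e → if d then 𝟙 e else 0)
           (dec-true (P? (k , c₀)) (Equivalence.from (P⇔ (k , c₀)) c₀≡0)) (dec-true (k Fin.≟ k) refl) ⟩
    1 ∎
    where
    open ≡-Reasoning

    indicator : Letter m r → ℕ
    indicator x = if does (P? x) then 𝟙 (isLetter m r k x) else 0

    c₀ : Fin (r k)
    c₀ = fromℕ< rk>0

    c₀≡0 : toℕ c₀ ≡ 0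
    c₀≡0 = Fin.toℕ-fromℕ< rk>0

    off-letter : ∀ {l} → l ≢ k → ∀ c → indicator (l , c) ≡ 0
    off-letter {l} l≢k c = trans
      (cong (λ d → if does (P? (l , c)) then 𝟙 d else 0) (dec-false (l Fin.≟ k) l≢k))
      (Bool.if-eta (does (P? (l , c))))

    off-color : ∀ {c} → c ≢ c₀ → indicator (k , c) ≡ 0
    off-color {c} c≢c₀ = cong (if_then 𝟙 (isLetter m r k (k , c)) else 0) (dec-false (P? (k , c))
      λ p → c≢c₀ (Fin.toℕ-injective (trans (Equivalence.to (P⇔ (k , c)) p) (sym c₀≡0))))

  ∞≺⇒ : ∀ x → (1 , suc n) ≺ code m r x → toℕ (proj₂ x) ≢ 0
  ∞≺⇒ (k , c) (inj₁ 1<) c≡0 = ℕ.<⇒≢ 1< (cong suc (sym c≡0))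
  ∞≺⇒ (k , c) (inj₂ (_ , n<k)) _ = ℕ.<⇒≱ (s≤s⁻¹ n<k) (ℕ.<⇒≤ (Fin.toℕ<n k))

  ∞≺⇐ : ∀ x → toℕ (proj₂ x) ≢ 0 → (1 , suc n) ≺ code m r x
  ∞≺⇐ (k , c) c≢0 = inj₁ (s≤s (ℕ.n≢0⇒n>0 c≢0))

  -- The appended letter has color 1 and exceeds every `k`, so exactly the letters of higher color
  -- lie above it.
  color-one-⇔ : ∀ x → does ((1 , suc n) ≺? code m r x) ≡ false ⇔ toℕ (proj₂ x) ≡ 0
  color-one-⇔ x = mk⇔ to from
    where
    to : does ((1 , suc n) ≺? code m r x) ≡ false → toℕ (proj₂ x) ≡ 0
    to ∞⊀ with toℕ (proj₂ x) ℕ.≟ 0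
    ... | yes c≡0 = c≡0
    ... | no  c≢0 = contradiction
      (trans (sym ∞⊀) (dec-true ((1 , suc n) ≺? code m r x) (∞≺⇐ x c≢0))) λ ()

    from : toℕ (proj₂ x) ≡ 0 → does ((1 , suc n) ≺? code m r x) ≡ false
    from c≡0 = dec-false ((1 , suc n) ≺? code m r x) λ ∞≺ → ∞≺⇒ x ∞≺ c≡0

  multiplicity-weak-initial : ∀ k → r k > 0 → multiplicity m r k Weak.initial ≡ 1
  multiplicity-weak-initial = multiplicity-color-one Weak.initial? color-one-⇔ Weak.sorted-↭

  -- In decreasing order, the cut removes exactly the letters of color 1.
  multiplicity-strict-initial : ∀ k → r k > 0 → suc (multiplicity m r k Strict.initial) ≡ r k
  multiplicity-strict-initial k rk>0 = begin
    suc (multiplicity m r k Strict.initial)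
      ≡⟨ ℕ.+-comm 1 _ ⟩
    multiplicity m r k Strict.initial + 1
      ≡⟨ cong (multiplicity m r k Strict.initial +_)
           (multiplicity-color-one (¬? ∘ Strict.initial?) (λ x → flipped x (color-one-⇔ x)) Strict.sorted-↭ k rk>0) ⟨
    multiplicity m r k Strict.initial + multiplicity m r k Strict.final
      ≡⟨ sumOver-++ Strict.initial Strict.final _ ⟨
    multiplicity m r k Strict.block
      ≡⟨ Strict.multiplicity-block k ⟩
    r k ∎
    where
    open ≡-Reasoning
    flipped : ∀ x {Q : Set} → does ((1 , suc n) ≺? code m r x) ≡ false ⇔ Q →
      (not (does ((1 , suc n) ≺? code m r x)) ≢ false) ⇔ Q
    flipped x eqv with does ((1 , suc n) ≺? code m r x)
    ... | true  = mk⇔ (contradiction refl) (λ q → contradiction (Equivalence.from eqv q) λ ())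
    ... | false = mk⇔ (λ _ → Equivalence.to eqv refl) (λ _ ())

  -- Letter `k` has `t * r k + 1` positions, the last one from the cut-off block.
  worpitzky : (∀ k → r k > 0) → ∀ t →
    sumOver (𝔖 m r) (λ w → (t + ∣𝐦∣ m r ∸ des m r w) C ∣𝐦∣ m r) ≡
    ∏ (λ k → (t * r k + m k) C m k)
  worpitzky r>0 t = begin
    sumOver (𝔖 m r) (λ w → (t + ∣𝐦∣ m r ∸ des m r w) C ∣𝐦∣ m r)
      ≡⟨ sumOver-cong (𝔖 m r) (λ {w} _ → cong (λ e → (t + ∣𝐦∣ m r ∸ e) C ∣𝐦∣ m r) (des≡breaks w)) ⟩
    sumOver (𝔖 m r) (λ w → (t + ∣𝐦∣ m r ∸ Weak.breaks w) C ∣𝐦∣ m r)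
      ≡⟨ Weak.∑-words-C t ⟩
    ∏ (λ k → choose false (t * r k + multiplicity m r k Weak.initial) (m k))
      ≡⟨ ∏-cong (λ k → trans
           (cong (λ a → choose false a (m k))
             (trans (cong (t * r k +_) (multiplicity-weak-initial k (r>0 k))) (ℕ.+-comm _ 1)))
           (choose-false (t * r k) (m k))) ⟩
    ∏ (λ k → (t * r k + m k) C m k) ∎
    where open ≡-Reasoning

  worpitzky-reciprocal : (∀ k → r k > 0) → ∀ t →
    sumOver (𝔖 m r) (λ w → (t + des m r w) C ∣𝐦∣ m r) ≡ ∏ (λ k → pred (suc t * r k) C m k)
  worpitzky-reciprocal r>0 t = begin
    sumOver (𝔖 m r) (λ w → (t + des m r w) C ∣𝐦∣ m r)
      ≡⟨ sumOver-cong (𝔖 m r) (λ {w} _ → cong (_C ∣𝐦∣ m r) (index w)) ⟩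
    sumOver (𝔖 m r) (λ w → (t + ∣𝐦∣ m r ∸ Strict.breaks w) C ∣𝐦∣ m r)
      ≡⟨ Strict.∑-words-C t ⟩
    ∏ (λ k → choose true (t * r k + multiplicity m r k Strict.initial) (m k))
      ≡⟨ ∏-cong (λ k → trans (choose-true _ (m k)) (cong (_C m k) (size k))) ⟩
    ∏ (λ k → pred (suc t * r k) C m k) ∎
    where
    open ≡-Reasoning

    index : ∀ {ℓ} (w : Word m r ℓ) → t + des m r w ≡ t + ℓ ∸ Strict.breaks w
    index {ℓ} w = begin
      t + des m r w
        ≡⟨ ℕ.m+n∸m≡n (Strict.breaks w) (t + des m r w) ⟨
      Strict.breaks w + (t + des m r w) ∸ Strict.breaks w
        ≡⟨ cong (_∸ Strict.breaks w) (x∙yz≈y∙xz (Strict.breaks w) t (des m r w)) ⟩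
      t + (Strict.breaks w + des m r w) ∸ Strict.breaks w
        ≡⟨ cong (λ a → t + a ∸ Strict.breaks w) (breaks+des w) ⟩
      t + ℓ ∸ Strict.breaks w ∎

    size : ∀ k → t * r k + multiplicity m r k Strict.initial ≡ pred (suc t * r k)
    size k = begin
      t * r k + multiplicity m r k Strict.initial
        ≡⟨ cong pred (ℕ.+-suc (t * r k) _) ⟨
      pred (t * r k + suc (multiplicity m r k Strict.initial))
        ≡⟨ cong (λ a → pred (t * r k + a)) (multiplicity-strict-initial k (r>0 k)) ⟩
      pred (t * r k + r k)
        ≡⟨ cong pred (ℕ.+-comm (t * r k) (r k)) ⟩
      pred (suc t * r k) ∎

  -- Symmetry and the common quotient of m_k + 1 by r_k.

  module _ (m>0 : ∀ k → m k > 0) (r>0 : ∀ k → r k > 0) (k₀ : Fin n) where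

    M : ℕ
    M = ∣𝐦∣ m r

    M>0 : M > 0
    M>0 = ℕ.≤-trans (m>0 k₀) (≤-sum-tabulate m k₀)

    prefixSum^-∑-X^ : ∀ (f : Word m r M → ℕ) t →
      prefixSum^ (suc M) (∑ (𝔖 m r) (X^_ ∘ f)) t ≡ sumOver (𝔖 m r) (λ w → (t + M ∸ f w) C M)
    prefixSum^-∑-X^ f t = trans (prefixSum^-∑ (suc M) (𝔖 m r) (X^_ ∘ f) t)
      (sumOver-cong (𝔖 m r) λ {w} _ → pointwise M>0 (f w))
      where
      -- `prefixSum^-X^` covers positive lower indices only, hence the match on `M`.
      pointwise : ∀ {M} → M > 0 → ∀ d → prefixSum^ (suc M) (X^ d) t ≡ (t + M ∸ d) C M
      pointwise {suc M} _ d = prefixSum^-X^ M d t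

    eulerian-0 : eulerian m r 0 ≡ 1
    eulerian-0 = begin
      eulerian m r 0                                        ≡⟨ prefixSum^-zero (suc M) (eulerian m r) ⟨
      prefixSum^ (suc M) (eulerian m r) 0                   ≡⟨ prefixSum^-∑-X^ (des m r) 0 ⟩
      sumOver (𝔖 m r) (λ w → (M ∸ des m r w) C M)           ≡⟨ worpitzky r>0 0 ⟩
      ∏ (λ k → m k C m k)                                   ≡⟨ ∏-one (λ k → nCn≡1 (m k)) ⟩
      1 ∎
      where open ≡-Reasoning

    -- In the reciprocal identity at `t = M ∸ d`, the summand of `w` is 1 if `des m r w` equals `d`
    -- and 0 if it is smaller.
    eulerian-leading : ∀ {d} → d ≤ M → (∀ {w} → w ∈ 𝔖 m r → des m r w ≤ d) →
      eulerian m r d ≡ ∏ (λ k → pred (suc (M ∸ d) * r k) C m k)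
    eulerian-leading {d} d≤M des≤d = trans
      (sumOver-cong (𝔖 m r) λ {w} w∈ → pointwise (des≤d w∈))
      (worpitzky-reciprocal r>0 (M ∸ d))
      where
      pointwise : ∀ {e} → e ≤ d → (X^ e) d ≡ (M ∸ d + e) C M
      pointwise {e} e≤d with e ℕ.≟ d
      ... | yes refl = trans (X^-refl d) (sym (trans (cong (_C M) (ℕ.m∸n+n≡m d≤M)) (nCn≡1 M)))
      ... | no  e≢d  = trans (X^-≢ (≢-sym e≢d)) (sym (k>n⇒nCk≡0
        (subst (M ∸ d + e <_) (ℕ.m∸n+n≡m d≤M) (ℕ.+-monoʳ-< (M ∸ d) (ℕ.≤∧≢⇒< e≤d e≢d)))))

    symmetric⇒ : SymmetricWrtDegree (eulerian m r) → ∃[ a ] (∀ k → a * r k ≡ suc (m k))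
    symmetric⇒ (d , (lead≢0 , above≡0) , symmetric) = suc (M ∸ d) , λ k →
      trans (sym (ℕ.suc-pred (suc (M ∸ d) * r k)
                   {{ >-nonZero (ℕ.m≤n⇒m≤n+o _ (r>0 k)) }}))
            (cong suc (nCk≡1⇒n≡k (m>0 k) (∏-one⁻ ∏≡1 k)))
      where
      des≤d : ∀ {w} → w ∈ 𝔖 m r → des m r w ≤ d
      des≤d {w} w∈ = ℕ.≮⇒≥ λ d<des → contradiction
        (trans (sym (X^-refl (des m r w))) (sumOver-zero⁻ (𝔖 m r) (above≡0 _ d<des) w∈)) λ ()

      d≤M : d ≤ M
      d≤M = ℕ.≮⇒≥ λ M<d → lead≢0 (sumOver-zero (𝔖 m r) λ {w} _ →
        X^-≢ (ℕ.>⇒≢ (ℕ.≤-<-trans (des≤ℓ w) M<d)))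

      ∏≡1 : ∏ (λ k → pred (suc (M ∸ d) * r k) C m k) ≡ 1
      ∏≡1 = trans (sym (eulerian-leading d≤M des≤d)) (trans (sym (symmetric 0 z≤n)) eulerian-0)

    module _ {a : ℕ} (a*r : ∀ k → suc a * r k ≡ suc (m k)) where

      a+des≤M : ∀ {w} → w ∈ 𝔖 m r → a + des m r w ≤ M
      a+des≤M {w} w∈ = bound a a*r
        where
        bound : ∀ a → (∀ k → suc a * r k ≡ suc (m k)) → a + des m r w ≤ M
        bound zero    a*r = des≤ℓ w
        -- The quotient is now `suc (suc a)`. At `t = a` the factor of `k₀` vanishes, hence every
        -- summand, which puts `a + des m r w` strictly below `M`.
        bound (suc a) a*r = nCk≡0⇒n<k (sumOver-zero⁻ (𝔖 m r)
          (trans (worpitzky-reciprocal r>0 a) (∏-zero k₀ (k>n⇒nCk≡0 small))) w∈)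
          where
          open ℕ.≤-Reasoning
          small : pred (suc a * r k₀) < m k₀
          small = s≤s⁻¹ (begin
            suc (suc (pred (suc a * r k₀)))
              ≡⟨ cong suc (ℕ.suc-pred (suc a * r k₀) {{ >-nonZero (ℕ.m≤n⇒m≤n+o _ (r>0 k₀)) }}) ⟩
            1 + suc a * r k₀          ≤⟨ ℕ.+-monoˡ-≤ (suc a * r k₀) (r>0 k₀) ⟩
            r k₀ + suc a * r k₀       ≡⟨ a*r k₀ ⟩
            suc (m k₀)                ∎)

      -- The common quotient is `suc a`, so this is M + 1 minus the quotient.
      d : ℕ
      d = M ∸ a

      des≤d : ∀ {w} → w ∈ 𝔖 m r → des m r w ≤ d
      des≤d {w} w∈ = ℕ.m+n≤o⇒m≤o∸n (des m r w) (subst (_≤ M) (ℕ.+-comm a _) (a+des≤M w∈))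

      reversed : Poly
      reversed = ∑ (𝔖 m r) (λ w → X^ (d ∸ des m r w))

      -- The product of the first identity at `t` is that of the second at `t + a`, so both sides
      -- have the same (M+1)-fold prefix sums.
      eulerian≗reversed : eulerian m r ≗ reversed
      eulerian≗reversed = prefixSum^-injective (suc M) λ t → begin
        prefixSum^ (suc M) (eulerian m r) t
          ≡⟨ prefixSum^-∑-X^ (des m r) t ⟩
        sumOver (𝔖 m r) (λ w → (t + M ∸ des m r w) C M)
          ≡⟨ worpitzky r>0 t ⟩
        ∏ (λ k → (t * r k + m k) C m k)
          ≡⟨ ∏-cong (λ k → cong (_C m k) (shift t k)) ⟩
        ∏ (λ k → pred (suc (t + a) * r k) C m k)
          ≡⟨ worpitzky-reciprocal r>0 (t + a) ⟨
        sumOver (𝔖 m r) (λ w → (t + a + des m r w) C M)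
          ≡⟨ sumOver-cong (𝔖 m r) (λ {w} w∈ → cong (_C M) (reflect t (des m r w) (a+des≤M w∈))) ⟩
        sumOver (𝔖 m r) (λ w → (t + M ∸ (d ∸ des m r w)) C M)
          ≡⟨ prefixSum^-∑-X^ (λ w → d ∸ des m r w) t ⟨
        prefixSum^ (suc M) reversed t ∎
        where
        open ≡-Reasoning

        shift : ∀ t k → t * r k + m k ≡ pred (suc (t + a) * r k)
        shift t k = begin
          t * r k + m k               ≡⟨ cong pred (ℕ.+-suc (t * r k) (m k)) ⟨
          pred (t * r k + suc (m k))  ≡⟨ cong (λ e → pred (t * r k + e)) (a*r k) ⟨
          pred (t * r k + suc a * r k) ≡⟨ cong pred (ℕ.*-distribʳ-+ (r k) t (suc a)) ⟨
          pred ((t + suc a) * r k)    ≡⟨ cong (λ e → pred (e * r k)) (ℕ.+-suc t a) ⟩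
          pred (suc (t + a) * r k)    ∎

        -- The bound keeps all truncated subtractions exact.
        reflect : ∀ t e → a + e ≤ M → t + a + e ≡ t + M ∸ (d ∸ e)
        reflect t e a+e≤M = begin
          t + a + e               ≡⟨ ℕ.+-assoc t a e ⟩
          t + (a + e)             ≡⟨ cong (t +_) (ℕ.m∸[m∸n]≡n a+e≤M) ⟨
          t + (M ∸ (M ∸ (a + e))) ≡⟨ ℕ.+-∸-assoc t (ℕ.m∸n≤m M (a + e)) ⟨
          t + M ∸ (M ∸ (a + e))   ≡⟨ cong (t + M ∸_) (ℕ.∸-+-assoc M a e) ⟨
          t + M ∸ (d ∸ e)         ∎

      symmetric⇐ : SymmetricWrtDegree (eulerian m r)
      symmetric⇐ = d , (lead≢0 , above≡0) , symmetric
        where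
        symmetric : SymmetricWrt d (eulerian m r)
        symmetric s s≤d = trans (eulerian≗reversed s)
          (sumOver-cong (𝔖 m r) λ w∈ → X^-∸ (des≤d w∈) s≤d)

        lead≢0 : eulerian m r d ≢ 0
        lead≢0 lead≡0 = contradiction (trans (sym eulerian-0) (trans (symmetric 0 z≤n) lead≡0)) λ ()

        above≡0 : ∀ s → d < s → eulerian m r s ≡ 0
        above≡0 s d<s = sumOver-zero (𝔖 m r) λ w∈ → X^-≢ (ℕ.>⇒≢ (ℕ.≤-<-trans (des≤d w∈) d<s))

theorem16 : (n : ℕ) → n ≥ 1 → (m r : Fin n → ℕ) →
    (∀ k → NonZero (m k)) → (r≢0 : ∀ k → NonZero (r k)) →
    SymmetricWrtDegree (eulerian m r) ⇔
    (∀ j → maxCeiling m r r≢0 * r j ≡ suc (m j))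
theorem16 n n≥1 m r m≢0 r≢0 = mk⇔ to from
  where
  k₀ : Fin n
  k₀ = fromℕ< n≥1

  m>0 : ∀ k → m k > 0
  m>0 k = >-nonZero⁻¹ (m k) {{ m≢0 k }}

  r>0 : ∀ k → r k > 0
  r>0 k = >-nonZero⁻¹ (r k) {{ r≢0 k }}

  to : SymmetricWrtDegree (eulerian m r) → ∀ j → maxCeiling m r r≢0 * r j ≡ suc (m j)
  -- Every fraction equals the integer `a`, hence so do all ceilings and their maximum; `k₀` keeps
  -- the maximum from being the default 0.
  to sym-deg with a , a*r ← symmetric⇒ m r m>0 r>0 k₀ sym-deg = λ j →
    trans (cong (_* r j) (max-const a k₀ λ k → trans
            (cong (λ s → ∣ ceiling (_/_ (ℤ.+ s) (r k) {{r≢0 k}}) ∣) (sym (a*r k)))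
            (ceiling-* a (r k) {{ r≢0 k }})))
          (a*r j)

  from : (∀ j → maxCeiling m r r≢0 * r j ≡ suc (m j)) → SymmetricWrtDegree (eulerian m r)
  from h = positive (maxCeiling m r r≢0) h
    where
    -- With the maximum replaced by an arbitrary `a`, the quotient can be matched; 0 is impossible
    -- because m_j + 1 is positive.
    positive : ∀ a → (∀ j → a * r j ≡ suc (m j)) → SymmetricWrtDegree (eulerian m r)
    positive zero    a*r = contradiction (a*r k₀) λ ()
    positive (suc a) a*r = symmetric⇐ m r m>0 r>0 k₀ {a} a*r
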